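{- If $S$ and the dimension of $x$ are finite, then there exists a rounding scheme $P$ whose performance ratio equals the integrality gap.
   Context: Setting: $x$ is a non-negative real vector representing a relaxed solution to some problem. $S$ is a set of allowable solutions, each also a nonnegative real vector (indexed by the same coordinates as $x$), and one wants to round $x$ to some $y\in S$. A (randomized) rounding scheme is a probability distribution $P$ on $S$. For a nonnegative weight function $w$ (a nonnegative vector indexed by the same coordinates), the cost of $x$ is $w\cdot x=\sum_i w_ix_i$ and the cost of $y\in S$ is $w\cdot y=\sum_i w_iy_i$. The performance ratio of $P$ is $\sup_w \frac{E_{y\in P}[w\cdot y]}{w\cdot x}$, where $E_{y\in P}$ denotes expectation over $y\in S$ chosen according to $P$. The integrality gap is $\sup_w \frac{\inf_{y\in S} w\cdot y}{w\cdot x}$. Both suprema are over nonnegative weight functions $w$ for which the ratio is defined, i.e. $w\cdot x>0$ (the value $+\infty$ is allowed). -}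

module Defs where

open import Level using (Level; _⊔_; suc)
open import Algebra.Bundles using (CommutativeRing)
open import Algebra.Core using (Op₁; Op₂)
import Algebra.Properties.Semiring.Sum as SemiringSum
open import Data.Fin.Base using (Fin)
open import Data.Nat.Base using (ℕ)
open import Data.Product.Base using (∃; ∃-syntax; _×_)
open import Data.Vec.Functional using (Vector)
open import Data.Vec.Functional.Relation.Binary.Pointwise using (Pointwise)
open import Function.Base using (flip)
open import Function.Definitions using (Injective)
import Relation.Binary.Construct.Add.Extrema.NonStrict as AddExtrema
open import Relation.Binary.Core using (Rel)
open import Relation.Binary.PropositionalEquality.Core using (_≡_)
open import Relation.Binary.Structures using (IsDecTotalOrder)
open import Relation.Nullary.Construct.Add.Extrema using (_±; [_])
open import Relation.Nullary.Negation.Core using (¬_)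
open import Relation.Unary using (Pred)

module _ {a r : Level} {A : Set a} (_≤_ : Rel A r) where

  IsUpperBound : ∀ {p} → Pred A p → A → Set (a ⊔ r ⊔ p)
  IsUpperBound P u = ∀ {x} → P x → x ≤ u

  IsSupremum : ∀ {p} → Pred A p → A → Set (a ⊔ r ⊔ p)
  IsSupremum P s = IsUpperBound P s × (∀ {u} → IsUpperBound P u → s ≤ u)

IsInfimum : ∀ {a r p} {A : Set a} → Rel A r → Pred A p → A → Set (a ⊔ r ⊔ p)
IsInfimum _≤_ = IsSupremum (flip _≤_)

-- The classical real numbers, given by their categorical axiomatisation as a
-- Dedekind-complete ordered field.  The order is decidable, as it is
-- classically.  The inverse is total, with 0# ⁻¹ unspecified.
record Reals (c ℓ : Level) : Set (suc (c ⊔ ℓ)) where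
  field
    commutativeRing : CommutativeRing c ℓ

  open CommutativeRing commutativeRing public

  infix  4 _≤_ _<_
  infix  8 _⁻¹
  infixl 7 _/_

  field
    _≤_             : Rel Carrier ℓ
    _⁻¹             : Op₁ Carrier
    isDecTotalOrder : IsDecTotalOrder _≈_ _≤_
    0≉1             : ¬ (0# ≈ 1#)
    ⁻¹-inverseʳ     : ∀ {x} → ¬ (x ≈ 0#) → x * x ⁻¹ ≈ 1#
    +-monoˡ-≤       : ∀ z {x y} → x ≤ y → x + z ≤ y + z
    *-nonNegative   : ∀ {x y} → 0# ≤ x → 0# ≤ y → 0# ≤ x * y
    complete        : (P : Pred Carrier (c ⊔ ℓ)) → ∃ P →
                      ∃ (IsUpperBound _≤_ P) → ∃ (IsSupremum _≤_ P)

  _<_ : Rel Carrier ℓ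
  x < y = x ≤ y × ¬ (x ≈ y)

  _/_ : Op₂ Carrier
  x / y = x * y ⁻¹

module Rounding {c ℓ : Level} (R : Reals c ℓ) where

  open Reals R
  open SemiringSum semiring using (sum)
  open AddExtrema _≤_ using (_≤±_)

  infix 7 _·_

  _·_ : ∀ {n} → Vector Carrier n → Vector Carrier n → Carrier
  w · v = sum (λ i → w i * v i)

  NonNegative : ∀ {n} → Vector Carrier n → Set ℓ
  NonNegative v = ∀ i → 0# ≤ v i

  -- A finite set of vectors is given by an enumeration without repetitions,
  -- so a distribution on the set is a distribution on the indices.
  record FiniteSolutionSet (n : ℕ) : Set (c ⊔ ℓ) where
    field
      size        : ℕ
      solution    : Fin size → Vector Carrier n
      distinct    : Injective _≡_ (Pointwise _≈_) solution
      nonNegative : ∀ k → NonNegative (solution k)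

  open FiniteSolutionSet public

  record RoundingScheme {n : ℕ} (S : FiniteSolutionSet n) : Set (c ⊔ ℓ) where
    field
      probability     : Vector Carrier (size S)
      probability-≥0  : NonNegative probability
      probability-sum : sum probability ≈ 1#

  open RoundingScheme public

  expectation : ∀ {n} {S : FiniteSolutionSet n} → RoundingScheme S →
                (Vector Carrier n → Carrier) → Carrier
  expectation {S = S} P f = sum (λ k → probability P k * f (solution S k))

  Costs : ∀ {n} → FiniteSolutionSet n → Vector Carrier n → Pred Carrier c
  Costs S w r = ∃[ k ] r ≡ w · solution S k

  Admissible : ∀ {n} → Vector Carrier n → Vector Carrier n → Set ℓ
  Admissible x w = NonNegative w × 0# < w · x

  -- Suprema are taken in the extended reals, so they may be +∞ (⊤±); the
  -- supremum over no weights at all (when x is zero) is ⊥±.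
  IsPerformanceRatio : ∀ {n} (x : Vector Carrier n) {S : FiniteSolutionSet n} →
                       RoundingScheme S → Carrier ± → Set (c ⊔ ℓ)
  IsPerformanceRatio x P = IsSupremum _≤±_ λ ρ →
    ∃[ w ] Admissible x w × ρ ≡ [ expectation P (w ·_) / (w · x) ]

  IsIntegralityGap : ∀ {n} (x : Vector Carrier n) → FiniteSolutionSet n →
                     Carrier ± → Set (c ⊔ ℓ)
  IsIntegralityGap x S = IsSupremum _≤±_ λ ρ →
    ∃[ w ] Admissible x w × ∃[ m ] IsInfimum _≤_ (Costs S w) m × ρ ≡ [ m / (w · x) ]

{-# OPTIONS --safe #-}
-- A scheme p has ratio at most γ iff E_p[y] ≤ γ x coordinatewise.  Ville's
-- alternative, applied to the vectors y_k − γ x, gives either such a p or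
-- weights w ≥ 0 with w·y_k > γ (w·x) for every k, and the latter violate the
-- integrality gap when γ is that gap.  If w·x = 0 they would make the gap
-- infinite, a case detected beforehand by applying the same alternative to the
-- coordinates where x vanishes.
module Submission where

open import Defs
import Algebra.Properties.CommutativeSemigroup as CommutativeSemigroupProperties
import Algebra.Properties.Group as GroupProperties
import Algebra.Properties.Ring as RingProperties
import Algebra.Properties.Semiring.Sum as SemiringSum
open import Data.Fin.Base using (Fin; zero; suc)
open import Data.Fin.Properties using (any?)
import Data.List.Base as List
import Data.List.Extrema as Extrema
open import Data.List.Membership.Propositional using (_∈_)
open import Data.List.Membership.Propositional.Properties
  using (∈-++⁺ˡ; ∈-++⁺ʳ; ∈-filter⁺; ∈-cartesianProductWith⁺; ∈-allFin)
open import Data.List.Relation.Unary.All as All using (All)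
import Data.List.Relation.Unary.All.Properties as All
open import Data.Nat.Base using (ℕ; zero; suc; NonZero)
open import Data.Product.Base using (∃-syntax; _×_; _,_; proj₁; proj₂)
open import Data.Sum.Base using (_⊎_; inj₁; inj₂)
open import Data.Vec.Functional using (Vector; head; tail; _∷_; replicate)
open import Function.Base using (_∘_; id)
open import Level using (_⊔_)
open import Relation.Binary.Bundles using (TotalOrder)
import Relation.Binary.Construct.Add.Extrema.NonStrict as AddExtrema
import Relation.Binary.Construct.Add.Supremum.NonStrict as AddSupremum
import Relation.Binary.PropositionalEquality as ≡
open ≡ using (_≡_)
import Relation.Binary.Properties.TotalOrder as TotalOrderProperties
import Relation.Binary.Reasoning.PartialOrder as PartialOrderReasoning
open import Relation.Binary.Structures using (IsDecTotalOrder)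
open import Relation.Nullary.Construct.Add.Extrema using (_±; ⊥±; ⊤±; [_])
open import Relation.Nullary.Decidable using (yes; no; ¬?; decidable-stable)
open import Relation.Nullary.Negation using (¬_; contradiction)
open import Relation.Unary using (Pred)

module OrderedField {c ℓ} (R : Reals c ℓ) where

  open Reals R hiding (zero)
  open IsDecTotalOrder isDecTotalOrder public using (_≤?_; _≟_; isTotalOrder)
  open GroupProperties +-group
    using (//-rightDividesˡ; //-rightDividesʳ) renaming (⁻¹-involutive to -‿involutive)
  open RingProperties ring using (-‿distribˡ-*)

  totalOrder : TotalOrder c ℓ ℓ
  totalOrder = record { isTotalOrder = isTotalOrder }

  open TotalOrder totalOrder public
    using (poset; antisym; total) renaming (refl to ≤-refl; trans to ≤-trans; reflexive to ≤-reflexive)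
  open TotalOrderProperties totalOrder public using (≰⇒>)
  open PartialOrderReasoning poset

  +-monoʳ-≤ : ∀ z {x y} → x ≤ y → z + x ≤ z + y
  +-monoʳ-≤ z {x} {y} x≤y = begin
    z + x  ≈⟨ +-comm z x ⟩
    x + z  ≤⟨ +-monoˡ-≤ z x≤y ⟩
    y + z  ≈⟨ +-comm y z ⟩
    z + y  ∎

  +-mono-≤ : ∀ {x y u v} → x ≤ y → u ≤ v → x + u ≤ y + v
  +-mono-≤ x≤y u≤v = ≤-trans (+-monoˡ-≤ _ x≤y) (+-monoʳ-≤ _ u≤v)

  +-nonNegative : ∀ {x y} → 0# ≤ x → 0# ≤ y → 0# ≤ x + y
  +-nonNegative {x} {y} 0≤x 0≤y = begin
    0#       ≈⟨ +-identityˡ 0# ⟨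
    0# + 0#  ≤⟨ +-mono-≤ 0≤x 0≤y ⟩
    x + y    ∎

  +-cancelʳ-≤ : ∀ z {x y} → x + z ≤ y + z → x ≤ y
  +-cancelʳ-≤ z {x} {y} le = begin
    x              ≈⟨ //-rightDividesʳ z x ⟨
    x + z + (- z)  ≤⟨ +-monoˡ-≤ (- z) le ⟩
    y + z + (- z)  ≈⟨ //-rightDividesʳ z y ⟩
    y              ∎

  x-y+y≈x : ∀ x y → (x - y) + y ≈ x
  x-y+y≈x x y = //-rightDividesˡ y x

  x≤y⇒0≤y-x : ∀ {x y} → x ≤ y → 0# ≤ y - x
  x≤y⇒0≤y-x {x} {y} x≤y = begin
    0#     ≈⟨ -‿inverseʳ x ⟨
    x - x  ≤⟨ +-monoˡ-≤ (- x) x≤y ⟩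
    y - x  ∎

  x-y≤z⇒x≤z+y : ∀ {x y z} → x - y ≤ z → x ≤ z + y
  x-y≤z⇒x≤z+y {x} {y} {z} le = begin
    x            ≈⟨ x-y+y≈x x y ⟨
    (x - y) + y  ≤⟨ +-monoˡ-≤ y le ⟩
    z + y        ∎

  x≤0⇒0≤-x : ∀ {x} → x ≤ 0# → 0# ≤ - x
  x≤0⇒0≤-x {x} x≤0 = begin
    0#        ≤⟨ x≤y⇒0≤y-x x≤0 ⟩
    0# + - x  ≈⟨ +-identityˡ (- x) ⟩
    - x       ∎

  *-monoˡ-≤ : ∀ {z x y} → 0# ≤ z → x ≤ y → z * x ≤ z * y
  *-monoˡ-≤ {z} {x} {y} 0≤z x≤y = begin
    z * x                  ≈⟨ +-identityˡ (z * x) ⟨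
    0# + z * x             ≤⟨ +-monoˡ-≤ (z * x) (*-nonNegative 0≤z (x≤y⇒0≤y-x x≤y)) ⟩
    z * (y - x) + z * x    ≈⟨ distribˡ z (y - x) x ⟨
    z * ((y - x) + x)      ≈⟨ *-congˡ (x-y+y≈x y x) ⟩
    z * y                  ∎

  *-monoʳ-≤ : ∀ {z x y} → 0# ≤ z → x ≤ y → x * z ≤ y * z
  *-monoʳ-≤ {z} {x} {y} 0≤z x≤y = begin
    x * z  ≈⟨ *-comm x z ⟩
    z * x  ≤⟨ *-monoˡ-≤ 0≤z x≤y ⟩
    z * y  ≈⟨ *-comm z y ⟩
    y * z  ∎

  0≤1 : 0# ≤ 1#
  0≤1 with total 0# 1#
  ... | inj₁ 0≤1 = 0≤1
  ... | inj₂ 1≤0 = begin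
    0#             ≤⟨ *-nonNegative 0≤-1 0≤-1 ⟩
    - 1# * - 1#    ≈⟨ -‿distribˡ-* 1# (- 1#) ⟨
    - (1# * - 1#)  ≈⟨ -‿cong (*-identityˡ (- 1#)) ⟩
    - (- 1#)       ≈⟨ -‿involutive 1# ⟩
    1#             ∎
    where
    0≤-1 = x≤0⇒0≤-x 1≤0

  1≰0 : ¬ (1# ≤ 0#)
  1≰0 1≤0 = 0≉1 (antisym 0≤1 1≤0)

  >⇒≉0 : ∀ {x} → 0# < x → ¬ (x ≈ 0#)
  >⇒≉0 (_ , 0≉x) x≈0 = 0≉x (sym x≈0)

  ⁻¹-nonNegative : ∀ {x} → 0# < x → 0# ≤ x ⁻¹
  ⁻¹-nonNegative {x} 0<x with total 0# (x ⁻¹)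
  ... | inj₁ 0≤x⁻¹ = 0≤x⁻¹
  ... | inj₂ x⁻¹≤0 = contradiction (begin
    1#        ≈⟨ ⁻¹-inverseʳ (>⇒≉0 0<x) ⟨
    x * x ⁻¹  ≤⟨ *-monoˡ-≤ (proj₁ 0<x) x⁻¹≤0 ⟩
    x * 0#    ≈⟨ zeroʳ x ⟩
    0#        ∎) 1≰0

  x/y*y≈x : ∀ x {y} → 0# < y → x / y * y ≈ x
  x/y*y≈x x {y} 0<y = begin-equality
    x * y ⁻¹ * y    ≈⟨ *-assoc x (y ⁻¹) y ⟩
    x * (y ⁻¹ * y)  ≈⟨ *-congˡ (*-comm (y ⁻¹) y) ⟩
    x * (y * y ⁻¹)  ≈⟨ *-congˡ (⁻¹-inverseʳ (>⇒≉0 0<y)) ⟩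
    x * 1#          ≈⟨ *-identityʳ x ⟩
    x               ∎

  x*y/y≈x : ∀ x {y} → 0# < y → x * y / y ≈ x
  x*y/y≈x x {y} 0<y = begin-equality
    x * y * y ⁻¹    ≈⟨ *-assoc x y (y ⁻¹) ⟩
    x * (y * y ⁻¹)  ≈⟨ *-congˡ (⁻¹-inverseʳ (>⇒≉0 0<y)) ⟩
    x * 1#          ≈⟨ *-identityʳ x ⟩
    x               ∎

  ≤*⇒/≤ : ∀ {x y z} → 0# < y → x ≤ z * y → x / y ≤ z
  ≤*⇒/≤ {x} {y} {z} 0<y le = begin
    x / y        ≤⟨ *-monoʳ-≤ (⁻¹-nonNegative 0<y) le ⟩
    z * y / y    ≈⟨ x*y/y≈x z 0<y ⟩
    z            ∎

  *≤⇒≤/ : ∀ {x y z} → 0# < y → z * y ≤ x → z ≤ x / y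
  *≤⇒≤/ {x} {y} {z} 0<y le = begin
    z            ≈⟨ x*y/y≈x z 0<y ⟨
    z * y / y    ≤⟨ *-monoʳ-≤ (⁻¹-nonNegative 0<y) le ⟩
    x / y        ∎

  /≤⇒≤* : ∀ {x y z} → 0# < y → x / y ≤ z → x ≤ z * y
  /≤⇒≤* {x} {y} {z} 0<y le = begin
    x          ≈⟨ x/y*y≈x x 0<y ⟨
    x / y * y  ≤⟨ *-monoʳ-≤ (proj₁ 0<y) le ⟩
    z * y      ∎

  *-cancelˡ-≤ : ∀ {z x y} → 0# < z → z * x ≤ z * y → x ≤ y
  *-cancelˡ-≤ {z} {x} {y} 0<z le = begin
    x          ≈⟨ x*y/y≈x x 0<z ⟨
    x * z / z  ≈⟨ *-congʳ (*-comm x z) ⟩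
    z * x / z  ≤⟨ *-monoʳ-≤ (⁻¹-nonNegative 0<z) le ⟩
    z * y / z  ≈⟨ *-congʳ (*-comm z y) ⟩
    y * z / z  ≈⟨ x*y/y≈x y 0<z ⟩
    y          ∎

  <-≤-trans : ∀ {x y z} → x < y → y ≤ z → x < z
  <-≤-trans {x} {y} {z} x<y y≤z = begin-strict x <⟨ x<y ⟩ y ≤⟨ y≤z ⟩ z ∎

module Sums {c ℓ} (R : Reals c ℓ) where

  open Reals R hiding (zero)
  open Rounding R
  open OrderedField R
  open SemiringSum semiring public
    using (sum; sum-cong-≋; sum-replicate-zero; ∑-distrib-+; ∑-comm; *-distribˡ-sum; *-distribʳ-sum)
  open CommutativeSemigroupProperties *-commutativeSemigroup using (x∙yz≈y∙xz)
  open Extrema totalOrder using (max; ⊥≤max; xs≤max)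
  open PartialOrderReasoning poset

  sum-mono-≤ : ∀ {n} {u v : Vector Carrier n} → (∀ i → u i ≤ v i) → sum u ≤ sum v
  sum-mono-≤ {zero}  u≤v = ≤-refl
  sum-mono-≤ {suc n} u≤v = +-mono-≤ (u≤v zero) (sum-mono-≤ (u≤v ∘ suc))

  sum-nonNegative : ∀ {n} {v : Vector Carrier n} → NonNegative v → 0# ≤ sum v
  sum-nonNegative {n} v≥0 = ≤-trans (≤-reflexive (sym (sum-replicate-zero n))) (sum-mono-≤ v≥0)

  lookup≤sum : ∀ {n} {v : Vector Carrier n} → NonNegative v → ∀ i → v i ≤ sum v
  lookup≤sum {v = v} v≥0 zero = begin
    v zero                 ≈⟨ +-identityʳ (v zero) ⟨
    v zero + 0#            ≤⟨ +-monoʳ-≤ (v zero) (sum-nonNegative (v≥0 ∘ suc)) ⟩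
    v zero + sum (tail v)  ∎
  lookup≤sum {v = v} v≥0 (suc i) = begin
    v (suc i)              ≤⟨ lookup≤sum (v≥0 ∘ suc) i ⟩
    sum (tail v)           ≈⟨ +-identityˡ (sum (tail v)) ⟨
    0# + sum (tail v)      ≤⟨ +-monoˡ-≤ (sum (tail v)) (v≥0 zero) ⟩
    v zero + sum (tail v)  ∎

  ·-nonNegative : ∀ {n} {w v : Vector Carrier n} → NonNegative w → NonNegative v → 0# ≤ w · v
  ·-nonNegative w≥0 v≥0 = sum-nonNegative λ i → *-nonNegative (w≥0 i) (v≥0 i)

  ·-congʳ : ∀ {n} (w : Vector Carrier n) {u v : Vector Carrier n} → (∀ i → u i ≈ v i) → w · u ≈ w · v
  ·-congʳ w u≈v = sum-cong-≋ λ i → *-congˡ (u≈v i)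

  ·-monoʳ-≤ : ∀ {n} {w u v : Vector Carrier n} → NonNegative w → (∀ i → u i ≤ v i) → w · u ≤ w · v
  ·-monoʳ-≤ w≥0 u≤v = sum-mono-≤ λ i → *-monoˡ-≤ (w≥0 i) (u≤v i)

  ·-+ʳ : ∀ {n} (w u v : Vector Carrier n) → w · (λ i → u i + v i) ≈ w · u + w · v
  ·-+ʳ w u v = trans (sum-cong-≋ λ i → distribˡ (w i) (u i) (v i)) (∑-distrib-+ (λ i → w i * u i) (λ i → w i * v i))

  ·-*ʳ : ∀ {n} (w : Vector Carrier n) a v → w · (λ i → a * v i) ≈ a * (w · v)
  ·-*ʳ w a v = trans (sum-cong-≋ λ i → x∙yz≈y∙xz (w i) a (v i)) (sym (*-distribˡ-sum a (λ i → w i * v i)))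

  ·-zeroʳ : ∀ {n} (w : Vector Carrier n) {v : Vector Carrier n} → (∀ i → v i ≈ 0#) → w · v ≈ 0#
  ·-zeroʳ {n} w v≈0 = trans (sum-cong-≋ λ i → trans (*-congˡ (v≈0 i)) (zeroʳ (w i))) (sum-replicate-zero n)

  ·-comm : ∀ {n} (w v : Vector Carrier n) → w · v ≈ v · w
  ·-comm w v = sum-cong-≋ λ i → *-comm (w i) (v i)

  ·-linearʳ : ∀ {n} (w : Vector Carrier n) a u b v →
              w · (λ i → a * u i + b * v i) ≈ a * (w · u) + b * (w · v)
  ·-linearʳ w a u b v = trans (·-+ʳ w (λ i → a * u i) (λ i → b * v i)) (+-cong (·-*ʳ w a u) (·-*ʳ w b v))

  ·-linearˡ : ∀ {n} a u b v (w : Vector Carrier n) →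
              (λ i → a * u i + b * v i) · w ≈ a * (u · w) + b * (v · w)
  ·-linearˡ a u b v w = begin-equality
    (λ i → a * u i + b * v i) · w  ≈⟨ ·-comm _ w ⟩
    w · (λ i → a * u i + b * v i)  ≈⟨ ·-linearʳ w a u b v ⟩
    a * (w · u) + b * (w · v)      ≈⟨ +-cong (*-congˡ (·-comm w u)) (*-congˡ (·-comm w v)) ⟩
    a * (u · w) + b * (v · w)      ∎

  ·-·-comm : ∀ {m n} (p : Vector Carrier m) (A : Fin m → Vector Carrier n) (w : Vector Carrier n) →
             p · (λ k → w · A k) ≈ w · (λ i → p · (λ k → A k i))
  ·-·-comm p A w = begin-equality
    sum (λ k → p k * sum (λ i → w i * A k i))
      ≈⟨ sum-cong-≋ (λ k → *-distribˡ-sum (p k) (λ i → w i * A k i)) ⟩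
    sum (λ k → sum (λ i → p k * (w i * A k i)))
      ≈⟨ ∑-comm (λ k i → p k * (w i * A k i)) ⟩
    sum (λ i → sum (λ k → p k * (w i * A k i)))
      ≈⟨ sum-cong-≋ (λ i → ·-*ʳ p (w i) (λ k → A k i)) ⟩
    sum (λ i → w i * sum (λ k → p k * A k i))  ∎

  dominated : ∀ {n} {x u : Vector Carrier n} → NonNegative x → (∀ i → x i ≈ 0# → u i ≤ 0#) →
              ∃[ γ ] ∀ i → u i ≤ γ * x i
  dominated {zero} _ _ = 0# , λ ()
  dominated {suc n} {x} {u} x≥0 u≤0 with dominated (x≥0 ∘ suc) (u≤0 ∘ suc) | x zero ≟ 0#
  ... | γ , u≤γx | yes x₀≈0 = γ , λ where
    zero    → ≤-trans (u≤0 zero x₀≈0) (≤-reflexive (sym (trans (*-congˡ x₀≈0) (zeroʳ γ))))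
    (suc i) → u≤γx i
  ... | γ , u≤γx | no x₀≉0 = γ′ , u≤γ′x
    where
    ratios = u zero / x zero List.∷ List.[]
    γ′ = max γ ratios

    u≤γ′x : ∀ i → u i ≤ γ′ * x i
    u≤γ′x zero    = /≤⇒≤* (x≥0 zero , λ 0≈x₀ → x₀≉0 (sym 0≈x₀)) (All.head (xs≤max γ ratios))
    u≤γ′x (suc i) = ≤-trans (u≤γx i) (*-monoʳ-≤ (x≥0 (suc i)) (⊥≤max γ ratios))

  indicator : ∀ {n} → Fin n → Vector Carrier n
  indicator zero    = 1# ∷ replicate _ 0#
  indicator (suc k) = 0# ∷ indicator k

  indicator-nonNegative : ∀ {n} (k : Fin n) → NonNegative (indicator k)
  indicator-nonNegative zero    zero    = 0≤1
  indicator-nonNegative zero    (suc i) = ≤-refl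
  indicator-nonNegative (suc k) zero    = ≤-refl
  indicator-nonNegative (suc k) (suc i) = indicator-nonNegative k i

  indicator-· : ∀ {n} (k : Fin n) v → indicator k · v ≈ v k
  indicator-· {suc n} zero v = begin-equality
    1# * v zero + sum (λ i → 0# * v (suc i))
      ≈⟨ +-cong (*-identityˡ (v zero)) (sum-cong-≋ λ i → zeroˡ (v (suc i))) ⟩
    v zero + sum (replicate n 0#)  ≈⟨ +-congˡ (sum-replicate-zero n) ⟩
    v zero + 0#                    ≈⟨ +-identityʳ (v zero) ⟩
    v zero                         ∎
  indicator-· (suc k) v = begin-equality
    0# * v zero + indicator k · tail v  ≈⟨ +-cong (zeroˡ (v zero)) (indicator-· k (tail v)) ⟩
    0# + v (suc k)                      ≈⟨ +-identityˡ (v (suc k)) ⟩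
    v (suc k)                           ∎

  ·-ones : ∀ {n} (v : Vector Carrier n) → v · replicate n 1# ≈ sum v
  ·-ones v = sum-cong-≋ λ i → *-identityʳ (v i)

  IsDistribution : ∀ {n} → Vector Carrier n → Set ℓ
  IsDistribution p = NonNegative p × sum p ≈ 1#

  indicator-isDistribution : ∀ {n} (k : Fin n) → IsDistribution (indicator k)
  indicator-isDistribution k =
    indicator-nonNegative k , trans (sym (·-ones (indicator k))) (indicator-· k (replicate _ 1#))

  mix-isDistribution : ∀ {n a b} {p q : Vector Carrier n} → 0# ≤ a → 0# ≤ b → a + b ≈ 1# →
                       IsDistribution p → IsDistribution q →
                       IsDistribution (λ i → a * p i + b * q i)
  mix-isDistribution {n} {a} {b} {p} {q} a≥0 b≥0 a+b≈1 (p≥0 , ∑p) (q≥0 , ∑q) =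
    (λ i → +-nonNegative (*-nonNegative a≥0 (p≥0 i)) (*-nonNegative b≥0 (q≥0 i))) ,
    (begin-equality
      sum (λ i → a * p i + b * q i)                    ≈⟨ ∑-distrib-+ (λ i → a * p i) (λ i → b * q i) ⟩
      sum (λ i → a * p i) + sum (λ i → b * q i)
        ≈⟨ +-cong (*-distribˡ-sum a p) (*-distribˡ-sum b q) ⟨
      a * sum p + b * sum q                            ≈⟨ +-cong (*-congˡ ∑p) (*-congˡ ∑q) ⟩
      a * 1# + b * 1#                                  ≈⟨ +-cong (*-identityʳ a) (*-identityʳ b) ⟩
      a + b                                            ≈⟨ a+b≈1 ⟩
      1#                                               ∎)

  distribution-constant : ∀ {n} {p : Vector Carrier n} → IsDistribution p → ∀ r → p · replicate n r ≈ r
  distribution-constant {p = p} (_ , ∑p) r = begin-equality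
    p · replicate _ r  ≈⟨ *-distribʳ-sum r p ⟨
    sum p * r          ≈⟨ *-congʳ ∑p ⟩
    1# * r             ≈⟨ *-identityˡ r ⟩
    r                  ∎

  distribution-≥ : ∀ {n r} {p v : Vector Carrier n} → IsDistribution p → (∀ k → r ≤ v k) → r ≤ p · v
  distribution-≥ {n} {r} {p} {v} dp r≤v = begin
    r                  ≈⟨ distribution-constant dp r ⟨
    p · replicate n r  ≤⟨ ·-monoʳ-≤ (proj₁ dp) r≤v ⟩
    p · v              ∎

module Alternative {c ℓ} (R : Reals c ℓ) where

  open Reals R hiding (zero)
  open Rounding R
  open OrderedField R
  open Sums R
  open Extrema totalOrder using (max; ⊥≤max; xs≤max; argmax-all)
  open PartialOrderReasoning poset

  infix 7 _⊖_

  -- The convex combination of a and b whose head vanishes.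
  weightˡ weightʳ : ∀ {m} → Vector Carrier (suc m) → Vector Carrier (suc m) → Carrier
  weightˡ a b = head b / (head b - head a)
  weightʳ a b = (- head a) / (head b - head a)

  _⊖_ : ∀ {m} → Vector Carrier (suc m) → Vector Carrier (suc m) → Vector Carrier (suc m)
  (a ⊖ b) i = weightˡ a b * a i + weightʳ a b * b i

  module _ {m} (a b : Vector Carrier (suc m)) (a≤0 : head a ≤ 0#) (0<b : 0# < head b) where

    private
      a₀ = head a
      b₀ = head b
      d⁻¹ = (b₀ - a₀) ⁻¹
      μ = weightˡ a b
      ν = weightʳ a b

    0<b-a : 0# < b₀ - a₀
    0<b-a = <-≤-trans 0<b (begin
      b₀       ≈⟨ +-identityʳ b₀ ⟨
      b₀ + 0#  ≤⟨ +-monoʳ-≤ b₀ (x≤0⇒0≤-x a≤0) ⟩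
      b₀ - a₀  ∎)

    weightˡ-positive : 0# < μ
    weightˡ-positive =
      *-nonNegative (proj₁ 0<b) (⁻¹-nonNegative 0<b-a) ,
      λ 0≈μ → proj₂ 0<b (begin-equality
        0#               ≈⟨ zeroˡ (b₀ - a₀) ⟨
        0# * (b₀ - a₀)   ≈⟨ *-congʳ 0≈μ ⟩
        μ * (b₀ - a₀)    ≈⟨ x/y*y≈x b₀ 0<b-a ⟩
        b₀               ∎)

    weightʳ-nonNegative : 0# ≤ ν
    weightʳ-nonNegative = *-nonNegative (x≤0⇒0≤-x a≤0) (⁻¹-nonNegative 0<b-a)

    weight-sum : μ + ν ≈ 1#
    weight-sum = begin-equality
      b₀ * d⁻¹ + - a₀ * d⁻¹  ≈⟨ distribʳ d⁻¹ b₀ (- a₀) ⟨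
      (b₀ - a₀) * d⁻¹        ≈⟨ ⁻¹-inverseʳ (>⇒≉0 0<b-a) ⟩
      1#                     ∎

    head-⊖ : head (a ⊖ b) ≈ 0#
    head-⊖ = begin-equality
      b₀ * d⁻¹ * a₀ + - a₀ * d⁻¹ * b₀    ≈⟨ +-cong (xy∙z≈zy∙x b₀ d⁻¹ a₀) refl ⟩
      a₀ * d⁻¹ * b₀ + - a₀ * d⁻¹ * b₀    ≈⟨ distribʳ b₀ (a₀ * d⁻¹) (- a₀ * d⁻¹) ⟨
      (a₀ * d⁻¹ + - a₀ * d⁻¹) * b₀       ≈⟨ *-congʳ (distribʳ d⁻¹ a₀ (- a₀)) ⟨
      (a₀ - a₀) * d⁻¹ * b₀               ≈⟨ *-congʳ (*-congʳ (-‿inverseʳ a₀)) ⟩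
      0# * d⁻¹ * b₀                      ≈⟨ *-congʳ (zeroˡ d⁻¹) ⟩
      0# * b₀                            ≈⟨ zeroˡ b₀ ⟩
      0#                                 ∎
      where open CommutativeSemigroupProperties *-commutativeSemigroup using (xy∙z≈zy∙x)

    extend-⊖ : ∀ t v → (t ∷ v) · b ≈ 1# → 1# ≤ v · tail (a ⊖ b) → 1# ≤ (t ∷ v) · a
    extend-⊖ t v tight le = *-cancelˡ-≤ weightˡ-positive (+-cancelʳ-≤ ν (begin
      μ * 1# + ν                                 ≈⟨ +-congʳ (*-identityʳ μ) ⟩
      μ + ν                                      ≈⟨ weight-sum ⟩
      1#                                         ≤⟨ le ⟩
      v · tail (a ⊖ b)                           ≈⟨ +-identityˡ _ ⟨
      0# + v · tail (a ⊖ b)                      ≈⟨ +-congʳ (trans (*-congˡ head-⊖) (zeroʳ t)) ⟨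
      (t ∷ v) · (a ⊖ b)                          ≈⟨ ·-linearʳ (t ∷ v) μ a ν b ⟩
      μ * ((t ∷ v) · a) + ν * ((t ∷ v) · b)      ≈⟨ +-congˡ (trans (*-congˡ tight) (*-identityʳ ν)) ⟩
      μ * ((t ∷ v) · a) + ν                      ∎))

  ConvexClosed : ∀ {m q} → Pred (Vector Carrier m) q → Set (c ⊔ ℓ ⊔ q)
  ConvexClosed Q = ∀ {μ ν a b} → 0# ≤ μ → 0# ≤ ν → μ + ν ≈ 1# → Q a → Q b → Q (λ i → μ * a i + ν * b i)

  -- Fourier–Motzkin elimination of the first weight from the inequalities
  -- 1 ≤ w · a.
  convexAlternative : ∀ {m} (Q : Pred (Vector Carrier m) (c ⊔ ℓ)) → ConvexClosed Q → ∀ {as} → All Q as →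
                      (∃[ w ] NonNegative w × All (λ a → 1# ≤ w · a) as) ⊎ (∃[ b ] Q b × ∀ i → b i ≤ 0#)
  convexAlternative {zero} Q Q-convex All.[] = inj₁ ((λ ()) , (λ ()) , All.[])
  convexAlternative {zero} Q Q-convex (q All.∷ _) = inj₂ (_ , q , λ ())
  convexAlternative {suc m} Q Q-convex {as} Qas =
    extend (convexAlternative Q′ Q′-convex (All.map⁺ (All.map (λ (q , h) → _ , q , h , ≡.refl) eliminated-Q)))
    where
    Q′ : Pred (Vector Carrier m) (c ⊔ ℓ)
    Q′ b = ∃[ a ] Q a × head a ≤ 0# × tail a ≡ b

    Q′-convex : ConvexClosed Q′
    Q′-convex {μ} {ν} μ≥0 ν≥0 μ+ν≈1 (a , qa , a≤0 , ≡.refl) (b , qb , b≤0 , ≡.refl) =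
      _ , Q-convex μ≥0 ν≥0 μ+ν≈1 qa qb , (begin
        μ * head a + ν * head b  ≤⟨ +-mono-≤ (*-monoˡ-≤ μ≥0 a≤0) (*-monoˡ-≤ ν≥0 b≤0) ⟩
        μ * 0# + ν * 0#          ≈⟨ +-cong (zeroʳ μ) (zeroʳ ν) ⟩
        0# + 0#                  ≈⟨ +-identityˡ 0# ⟩
        0#                       ∎) , ≡.refl

    nonPositive? = λ (a : Vector Carrier (suc m)) → head a ≤? 0#
    positive?    = λ (a : Vector Carrier (suc m)) → ¬? (head a ≤? 0#)

    as⁻ = List.filter nonPositive? as
    as⁺ = List.filter positive? as

    as⁺-positive : All (λ b → 0# < head b) as⁺
    as⁺-positive = All.map ≰⇒> (All.all-filter positive? as)

    eliminated = as⁻ List.++ List.cartesianProductWith _⊖_ as⁻ as⁺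

    eliminated-Q : All (λ a → Q a × head a ≤ 0#) eliminated
    eliminated-Q = All.++⁺ all⁻
      (All.cartesianProductWith⁺ (≡.setoid _) (≡.setoid _) _⊖_ as⁻ as⁺ λ {a} {b} a∈ b∈ →
        let qa , a≤0 = All.lookup all⁻ a∈
            0<b = All.lookup as⁺-positive b∈
        in Q-convex (proj₁ (weightˡ-positive a b a≤0 0<b)) (weightʳ-nonNegative a b a≤0 0<b) (weight-sum a b a≤0 0<b)
             qa (All.lookup (All.filter⁺ positive? Qas) b∈) ,
           ≤-reflexive (head-⊖ a b a≤0 0<b))
      where
      all⁻ = All.zip (All.filter⁺ nonPositive? Qas , All.all-filter nonPositive? as)

    extend : (∃[ v ] NonNegative v × All (λ b → 1# ≤ v · b) (List.map tail eliminated)) ⊎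
             (∃[ b ] Q′ b × ∀ i → b i ≤ 0#) →
             (∃[ w ] NonNegative w × All (λ a → 1# ≤ w · a) as) ⊎ (∃[ b ] Q b × ∀ i → b i ≤ 0#)
    extend (inj₂ (_ , (a , qa , a≤0 , ≡.refl) , b≤0)) =
      inj₂ (a , qa , λ { zero → a≤0 ; (suc i) → b≤0 i })
    extend (inj₁ (v , v≥0 , 1≤v·b)) =
      inj₁ (t ∷ v , (λ { zero → ⊥≤max 0# bounds ; (suc i) → v≥0 i }) , All.tabulate satisfied)
      where
      bound : Vector Carrier (suc m) → Carrier
      bound b = (1# - v · tail b) / head b

      bounds = List.map bound as⁺
      t = max 0# bounds

      1≤v·tail : ∀ {a} → a ∈ eliminated → 1# ≤ v · tail a
      1≤v·tail = All.lookup (All.map⁻ 1≤v·b)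

      bound-tight : ∀ b → 0# < head b → (bound b ∷ v) · b ≈ 1#
      bound-tight b 0<b = trans (+-congʳ (x/y*y≈x _ 0<b)) (x-y+y≈x 1# (v · tail b))

      satisfied : ∀ {a} → a ∈ as → 1# ≤ (t ∷ v) · a
      satisfied {a} a∈ with head a ≤? 0#
      ... | no a≰0 = x-y≤z⇒x≤z+y (/≤⇒≤* (≰⇒> a≰0)
        (All.lookup (All.map⁻ (xs≤max 0# bounds)) (∈-filter⁺ positive? a∈ a≰0)))
      ... | yes a≤0 = argmax-all id {P = λ s → 1# ≤ (s ∷ v) · a}
        (begin
          1#                           ≤⟨ 1≤v·tail (∈-++⁺ˡ a∈⁻) ⟩
          v · tail a                   ≈⟨ +-identityˡ _ ⟨
          0# + v · tail a              ≈⟨ +-congʳ (zeroˡ (head a)) ⟨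
          (0# ∷ v) · a                 ∎)
        (All.map⁺ (All.tabulate λ {b} b∈ →
          let 0<b = All.lookup as⁺-positive b∈
          in extend-⊖ a b a≤0 0<b (bound b) v (bound-tight b 0<b)
               (1≤v·tail (∈-++⁺ʳ as⁻ (∈-cartesianProductWith⁺ _⊖_ a∈⁻ b∈)))))
        where
        a∈⁻ = ∈-filter⁺ nonPositive? a∈ a≤0

  ville : ∀ {s n} (A : Fin s → Vector Carrier n) →
          (∃[ w ] NonNegative w × ∀ k → 1# ≤ w · A k) ⊎
          (∃[ p ] IsDistribution p × ∀ i → p · (λ k → A k i) ≤ 0#)
  ville {s} {n} A with convexAlternative Hull Hull-convex (All.tabulate⁺ A∈Hull)
    where
    Hull : Pred (Vector Carrier n) (c ⊔ ℓ)
    Hull b = ∃[ p ] IsDistribution p × ∀ i → p · (λ k → A k i) ≈ b i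

    Hull-convex : ConvexClosed Hull
    Hull-convex {μ} {ν} {a} {b} μ≥0 ν≥0 μ+ν≈1 (p , dp , p≈a) (q , dq , q≈b) =
      _ , mix-isDistribution μ≥0 ν≥0 μ+ν≈1 dp dq , λ i → let Aᵢ = λ k → A k i in begin-equality
        (λ k → μ * p k + ν * q k) · Aᵢ  ≈⟨ ·-linearˡ μ p ν q Aᵢ ⟩
        μ * (p · Aᵢ) + ν * (q · Aᵢ)     ≈⟨ +-cong (*-congˡ (p≈a i)) (*-congˡ (q≈b i)) ⟩
        μ * a i + ν * b i               ∎

    A∈Hull : ∀ k → Hull (A k)
    A∈Hull k = indicator k , indicator-isDistribution k , λ i → indicator-· k (λ k → A k i)
  ... | inj₁ (w , w≥0 , 1≤w·A) = inj₁ (w , w≥0 , All.tabulate⁻ 1≤w·A)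
  ... | inj₂ (b , (p , dp , p≈b) , b≤0) = inj₂ (p , dp , λ i → ≤-trans (≤-reflexive (p≈b i)) (b≤0 i))

module ExtendedSuprema {c ℓ} (R : Reals c ℓ) where

  open Reals R hiding (zero)
  open OrderedField R
  open AddExtrema _≤_ using (_≤±_; ≤±-maximum; [≤]-injective) renaming ([_] to ≤[_])

  module _ {q} {Q : Pred (Carrier ±) q} where

    []-supremum : (∀ {ρ} → Q ρ → ∃[ r ] ρ ≡ [ r ]) → ∃[ r ] Q [ r ] →
                  ∀ {γ} → IsSupremum _≤_ (λ r → Q [ r ]) γ → IsSupremum _≤±_ Q [ γ ]
    []-supremum finite (r , Qr) {γ} (upper , least) = upper± , least±
      where
      upper± : IsUpperBound _≤±_ Q [ γ ]
      upper± Qρ with finite Qρ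
      ... | _ , ≡.refl = ≤[ upper Qρ ]

      least± : ∀ {u} → IsUpperBound _≤±_ Q u → [ γ ] ≤± u
      least± {⊤±} _ = ≤±-maximum _
      least± {⊥±} Q≤⊥ with Q≤⊥ Qr
      ... | AddSupremum.[ () ]
      least± {[ v ]} Q≤v = ≤[ least (λ Qs → [≤]-injective (Q≤v Qs)) ]

    ⊤-supremum : (∀ {N} → 0# ≤ N → ∃[ r ] N ≤ r × Q [ r ]) → IsSupremum _≤±_ Q ⊤±
    ⊤-supremum unbounded = (λ _ → ≤±-maximum _) , least±
      where
      least± : ∀ {u} → IsUpperBound _≤±_ Q u → ⊤± ≤± u
      least± {⊤±} _ = ≤±-maximum _
      least± {⊥±} Q≤⊥ with Q≤⊥ (proj₂ (proj₂ (unbounded ≤-refl)))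
      ... | AddSupremum.[ () ]
      least± {[ v ]} Q≤v = contradiction (+-cancelʳ-≤ v 1+v≤0+v) 1≰0
        where
        below : ∀ {N} → 0# ≤ N → N ≤ v
        below 0≤N with unbounded 0≤N
        ... | _ , N≤r , Qr = ≤-trans N≤r ([≤]-injective (Q≤v Qr))

        1+v≤0+v : 1# + v ≤ 0# + v
        1+v≤0+v = ≤-trans (below (+-nonNegative 0≤1 (below ≤-refl))) (≤-reflexive (sym (+-identityˡ v)))

module Relaxation {c ℓ} (R : Reals c ℓ) {n} (x : Vector (Reals.Carrier R) n)
                  (x≥0 : Rounding.NonNegative R x)
                  (S : Rounding.FiniteSolutionSet R n) (k₀ : Fin (Rounding.size S)) where

  open Reals R hiding (zero)
  open Rounding R
  open OrderedField R
  open Sums R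
  open Alternative R
  open ExtendedSuprema R
  open AddExtrema _≤_ using (_≤±_; ≤±-minimum; ≤±-trans) renaming ([_] to ≤[_])
  open Extrema totalOrder using (argmin; f[argmin]≤f[xs])
  open PartialOrderReasoning poset

  Performance : RoundingScheme S → Pred (Carrier ±) (c ⊔ ℓ)
  Performance P ρ = ∃[ w ] Admissible x w × ρ ≡ [ expectation P (w ·_) / (w · x) ]

  Gap : Pred (Carrier ±) (c ⊔ ℓ)
  Gap ρ = ∃[ w ] Admissible x w × ∃[ m ] IsInfimum _≤_ (Costs S w) m × ρ ≡ [ m / (w · x) ]

  y : Fin (size S) → Vector Carrier n
  y = solution S

  yᵢ : Fin n → Vector Carrier (size S)
  yᵢ i k = y k i

  scheme : ∀ {p} → IsDistribution p → RoundingScheme S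
  scheme {p} (p≥0 , ∑p) = record { probability = p ; probability-≥0 = p≥0 ; probability-sum = ∑p }

  distribution : (P : RoundingScheme S) → IsDistribution (probability P)
  distribution P = probability-≥0 P , probability-sum P

  costs-infimum : ∀ w → ∃[ m ] IsInfimum _≤_ (Costs S w) m
  costs-infimum w = cost k , (λ { (j , ≡.refl) → k-minimal j }) , λ u≤ → u≤ (k , ≡.refl)
    where
    cost : Fin (size S) → Carrier
    cost j = w · y j

    k = argmin cost k₀ (List.allFin (size S))

    k-minimal : ∀ j → cost k ≤ cost j
    k-minimal j = All.lookup (f[argmin]≤f[xs] {f = cost} k₀ (List.allFin (size S))) (∈-allFin j)

  ≤infimum : ∀ {w m r} → IsInfimum _≤_ (Costs S w) m → (∀ k → r ≤ w · y k) → r ≤ m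
  ≤infimum (_ , greatest) r≤ = greatest λ { (k , ≡.refl) → r≤ k }

  infimum≤expectation : ∀ (P : RoundingScheme S) {w m} → IsInfimum _≤_ (Costs S w) m → m ≤ expectation P (w ·_)
  infimum≤expectation P (lower , _) = distribution-≥ (distribution P) λ k → lower (k , ≡.refl)

  gap≤performance : ∀ P {u} → IsUpperBound _≤±_ (Performance P) u → IsUpperBound _≤±_ Gap u
  gap≤performance P performance≤u (w , w-adm@(_ , 0<wx) , m , m-inf , ≡.refl) =
    ≤±-trans ≤-trans
      ≤[ *-monoʳ-≤ (⁻¹-nonNegative 0<wx) (infimum≤expectation P m-inf) ]
      (performance≤u (w , w-adm , ≡.refl))

  expectation-≤ : ∀ (P : RoundingScheme S) {γ} → (∀ i → probability P · yᵢ i ≤ γ * x i) →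
                  ∀ {w} → NonNegative w → expectation P (w ·_) ≤ γ * (w · x)
  expectation-≤ P {γ} Py≤γx {w} w≥0 = begin
    probability P · (λ k → w · y k)       ≈⟨ ·-·-comm (probability P) y w ⟩
    w · (λ i → probability P · yᵢ i)      ≤⟨ ·-monoʳ-≤ w≥0 Py≤γx ⟩
    w · (λ i → γ * x i)                   ≈⟨ ·-*ʳ w γ x ⟩
    γ * (w · x)                           ∎

  RatioAchieved : Set (c ⊔ ℓ)
  RatioAchieved = ∃[ P ] ∃[ γ ] IsPerformanceRatio x {S} P γ × IsIntegralityGap x S γ

  pointMass : RoundingScheme S
  pointMass = scheme (indicator-isDistribution k₀)

  achieved-zero : (∀ i → x i ≈ 0#) → RatioAchieved
  achieved-zero x≈0 = pointMass , ⊥± ,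
    ((λ { (w , w-adm , _) → contradiction w-adm inadmissible }) , λ _ → ≤±-minimum _) ,
    ((λ { (w , w-adm , _) → contradiction w-adm inadmissible }) , λ _ → ≤±-minimum _)
    where
    inadmissible : ∀ {w} → ¬ Admissible x w
    inadmissible {w} (_ , 0<wx) = >⇒≉0 0<wx (·-zeroʳ w x≈0)

  ones-admissible : ∀ i → ¬ (x i ≈ 0#) → Admissible x (replicate n 1#)
  ones-admissible i xᵢ≉0 = (λ _ → 0≤1) , <-≤-trans (x≥0 i , λ 0≈xᵢ → xᵢ≉0 (sym 0≈xᵢ)) (begin
    x i                 ≤⟨ lookup≤sum x≥0 i ⟩
    sum x               ≈⟨ ·-ones x ⟨
    x · replicate n 1#  ≈⟨ ·-comm x (replicate n 1#) ⟩
    replicate n 1# · x  ∎)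

  achieved-infinite : ∀ {e w} → Admissible x e → NonNegative w → w · x ≈ 0# → (∀ k → 1# ≤ w · y k) →
                      RatioAchieved
  achieved-infinite {e} {w} (e≥0 , 0<ex) w≥0 wx≈0 1≤wy = pointMass , ⊤± ,
    ⊤-supremum (λ {N} N≥0 → _ ,
      *≤⇒≤/ (0<Wx N) (distribution-≥ (distribution pointMass) (cost-≥ N N≥0)) ,
      W N , (W≥0 N≥0 , 0<Wx N) , ≡.refl) ,
    ⊤-supremum (λ {N} N≥0 →
      let m , m-inf = costs-infimum (W N) in _ ,
      *≤⇒≤/ (0<Wx N) (≤infimum m-inf (cost-≥ N N≥0)) ,
      W N , (W≥0 N≥0 , 0<Wx N) , m , m-inf , ≡.refl)
    where
    W : Carrier → Vector Carrier n
    W N i = N * (e · x) * w i + 1# * e i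

    W≥0 : ∀ {N} → 0# ≤ N → NonNegative (W N)
    W≥0 N≥0 i = +-nonNegative (*-nonNegative (*-nonNegative N≥0 (proj₁ 0<ex)) (w≥0 i)) (*-nonNegative 0≤1 (e≥0 i))

    Wx≈ex : ∀ N → W N · x ≈ e · x
    Wx≈ex N = begin-equality
      W N · x                                 ≈⟨ ·-linearˡ (N * (e · x)) w 1# e x ⟩
      N * (e · x) * (w · x) + 1# * (e · x)    ≈⟨ +-cong (trans (*-congˡ wx≈0) (zeroʳ _)) (*-identityˡ (e · x)) ⟩
      0# + e · x                              ≈⟨ +-identityˡ (e · x) ⟩
      e · x                                   ∎

    0<Wx : ∀ N → 0# < W N · x
    0<Wx N = <-≤-trans 0<ex (≤-reflexive (sym (Wx≈ex N)))

    cost-≥ : ∀ N → 0# ≤ N → ∀ k → N * (W N · x) ≤ W N · y k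
    cost-≥ N N≥0 k = begin
      N * (W N · x)                             ≈⟨ *-congˡ (Wx≈ex N) ⟩
      N * (e · x)                               ≈⟨ *-identityʳ _ ⟨
      N * (e · x) * 1#                          ≈⟨ +-identityʳ _ ⟨
      N * (e · x) * 1# + 0#
        ≤⟨ +-mono-≤ (*-monoˡ-≤ (*-nonNegative N≥0 (proj₁ 0<ex)) (1≤wy k))
                    (*-nonNegative 0≤1 (·-nonNegative e≥0 (nonNegative S k))) ⟩
      N * (e · x) * (w · y k) + 1# * (e · y k)  ≈⟨ ·-linearˡ (N * (e · x)) w 1# e (y k) ⟨
      W N · y k                                 ∎

  violation⇒cost : ∀ {γ} w k → 1# ≤ w · (λ i → y k i - γ * x i) → 1# + γ * (w · x) ≤ w · y k
  violation⇒cost {γ} w k 1≤ = begin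
    1# + γ * (w · x)                                     ≤⟨ +-monoˡ-≤ (γ * (w · x)) 1≤ ⟩
    w · (λ i → y k i - γ * x i) + γ * (w · x)            ≈⟨ +-congˡ (·-*ʳ w γ x) ⟨
    w · (λ i → y k i - γ * x i) + w · (λ i → γ * x i)    ≈⟨ ·-+ʳ w (λ i → y k i - γ * x i) (λ i → γ * x i) ⟨
    w · (λ i → (y k i - γ * x i) + γ * x i)              ≈⟨ ·-congʳ w (λ i → x-y+y≈x (y k i) (γ * x i)) ⟩
    w · y k                                              ∎

  no-violation : ∀ {γ₀ γ} (P : RoundingScheme S) → (∀ i → probability P · yᵢ i ≤ γ₀ * x i) →
                 IsUpperBound _≤_ (λ r → Gap [ r ]) γ →
                 ∀ {w} → NonNegative w → ¬ (∀ k → 1# ≤ w · (λ i → y k i - γ * x i))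
  no-violation {γ₀} {γ} P Py≤γ₀x gap≤γ {w} w≥0 1≤wA with w · x ≟ 0#
  ... | yes wx≈0 = 1≰0 (begin
    1#                      ≈⟨ +-identityʳ 1# ⟨
    1# + 0#                 ≈⟨ +-congˡ (trans (*-congˡ wx≈0) (zeroʳ γ)) ⟨
    1# + γ * (w · x)        ≤⟨ distribution-≥ (distribution P) (λ k → violation⇒cost w k (1≤wA k)) ⟩
    expectation P (w ·_)    ≤⟨ expectation-≤ P Py≤γ₀x w≥0 ⟩
    γ₀ * (w · x)            ≈⟨ trans (*-congˡ wx≈0) (zeroʳ γ₀) ⟩
    0#                      ∎)
  ... | no wx≉0 = 1≰0 (+-cancelʳ-≤ (γ * (w · x)) (begin
    1# + γ * (w · x)  ≤⟨ ≤infimum m-inf (λ k → violation⇒cost w k (1≤wA k)) ⟩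
    m                 ≤⟨ /≤⇒≤* 0<wx (gap≤γ (w , (w≥0 , 0<wx) , m , m-inf , ≡.refl)) ⟩
    γ * (w · x)       ≈⟨ +-identityˡ _ ⟨
    0# + γ * (w · x)  ∎))
    where
    m = proj₁ (costs-infimum w)
    m-inf = proj₂ (costs-infimum w)
    0<wx : 0# < w · x
    0<wx = ·-nonNegative w≥0 x≥0 , λ 0≈wx → wx≉0 (sym 0≈wx)

  achieved-finite : ∀ {e γ₀} (P : RoundingScheme S) → Admissible x e → (∀ i → probability P · yᵢ i ≤ γ₀ * x i) → RatioAchieved
  achieved-finite {e} {γ₀} P e-adm@(_ , 0<ex) Py≤γ₀x =
    optimal (complete (λ r → Gap [ r ]) (_ , gap-e) (γ₀ , gap≤γ₀))
    where
    gap-e : Gap [ proj₁ (costs-infimum e) / (e · x) ]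
    gap-e = e , e-adm , _ , proj₂ (costs-infimum e) , ≡.refl

    gap≤γ₀ : IsUpperBound _≤_ (λ r → Gap [ r ]) γ₀
    gap≤γ₀ (w , (w≥0 , 0<wx) , m , m-inf , ≡.refl) =
      ≤*⇒/≤ 0<wx (≤-trans (infimum≤expectation P m-inf) (expectation-≤ P Py≤γ₀x w≥0))

    optimal : ∃[ γ ] IsSupremum _≤_ (λ r → Gap [ r ]) γ → RatioAchieved
    optimal (γ , γ-sup) with ville (λ k i → y k i - γ * x i)
    ... | inj₁ (w , w≥0 , 1≤wA) = contradiction 1≤wA (no-violation P Py≤γ₀x (proj₁ γ-sup) w≥0)
    ... | inj₂ (p , dp , pA≤0) = scheme dp , [ γ ] ,
      ((λ { (w , (w≥0 , 0<wx) , ≡.refl) → ≤[ ≤*⇒/≤ 0<wx (expectation-≤ (scheme dp) py≤γx w≥0) ] }) ,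
       λ performance≤u → proj₂ gap-sup (gap≤performance (scheme dp) performance≤u)) ,
      gap-sup
      where
      gap-sup : IsIntegralityGap x S [ γ ]
      gap-sup = []-supremum (λ { (_ , _ , _ , _ , ρ≡) → _ , ρ≡ }) (_ , gap-e) γ-sup

      py≤γx : ∀ i → p · yᵢ i ≤ γ * x i
      py≤γx i = begin
        p · yᵢ i                                                  ≈⟨ ·-congʳ p (λ k → x-y+y≈x (y k i) (γ * x i)) ⟨
        p · (λ k → (y k i - γ * x i) + γ * x i)                   ≈⟨ ·-+ʳ p (λ k → y k i - γ * x i) (λ _ → γ * x i) ⟩
        p · (λ k → y k i - γ * x i) + p · replicate _ (γ * x i)
          ≤⟨ +-mono-≤ (pA≤0 i) (≤-reflexive (distribution-constant dp (γ * x i))) ⟩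
        0# + γ * x i                                              ≈⟨ +-identityˡ _ ⟩
        γ * x i                                                   ∎

  zeroIndicator : Vector Carrier n
  zeroIndicator i with x i ≟ 0#
  ... | yes _ = 1#
  ... | no  _ = 0#

  zeroIndicator-nonNegative : NonNegative zeroIndicator
  zeroIndicator-nonNegative i with x i ≟ 0#
  ... | yes _ = 0≤1
  ... | no  _ = ≤-refl

  zeroIndicator-*x : ∀ i → zeroIndicator i * x i ≈ 0#
  zeroIndicator-*x i with x i ≟ 0#
  ... | yes xᵢ≈0 = trans (*-identityˡ (x i)) xᵢ≈0
  ... | no  _    = zeroˡ (x i)

  zeroIndicator-one : ∀ i → x i ≈ 0# → zeroIndicator i ≈ 1#
  zeroIndicator-one i xᵢ≈0 with x i ≟ 0#
  ... | yes _    = refl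
  ... | no  xᵢ≉0 = contradiction xᵢ≈0 xᵢ≉0

  -- Whether the gap is infinite is decided by the coordinates where x vanishes.
  achieved-nonzero : ∀ {e} → Admissible x e → RatioAchieved
  achieved-nonzero e-adm with ville (λ k i → zeroIndicator i * y k i)
  ... | inj₁ (w , w≥0 , 1≤wA) = achieved-infinite e-adm
    (λ i → *-nonNegative (w≥0 i) (zeroIndicator-nonNegative i))
    (begin-equality
      (λ i → w i * zeroIndicator i) · x     ≈⟨ sum-cong-≋ (λ i → *-assoc (w i) (zeroIndicator i) (x i)) ⟩
      w · (λ i → zeroIndicator i * x i)     ≈⟨ ·-zeroʳ w zeroIndicator-*x ⟩
      0#                                    ∎)
    (λ k → ≤-trans (1≤wA k) (≤-reflexive (sum-cong-≋ λ i → sym (*-assoc (w i) (zeroIndicator i) (y k i)))))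
  ... | inj₂ (p , dp , pA≤0) =
    let γ₀ , py≤γ₀x = dominated x≥0 λ i xᵢ≈0 → ≤-trans (≤-reflexive (sym (scaled i xᵢ≈0))) (pA≤0 i)
    in achieved-finite (scheme dp) e-adm py≤γ₀x
    where
    scaled : ∀ i → x i ≈ 0# → p · (λ k → zeroIndicator i * y k i) ≈ p · yᵢ i
    scaled i xᵢ≈0 = ·-congʳ p λ k → trans (*-congʳ (zeroIndicator-one i xᵢ≈0)) (*-identityˡ (y k i))

  achieved : RatioAchieved
  achieved with any? (λ i → ¬? (x i ≟ 0#))
  ... | yes (i , xᵢ≉0) = achieved-nonzero (ones-admissible i xᵢ≉0)
  ... | no ∄≉0 = achieved-zero λ i → decidable-stable (x i ≟ 0#) λ xᵢ≉0 → ∄≉0 (i , xᵢ≉0)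

theorem7p2 : ∀ {c ℓ} (R : Reals c ℓ) →
    let open Reals R
        open Rounding R
    in
    (n : ℕ) (x : Vector Carrier n) → NonNegative x →
    (S : FiniteSolutionSet n) → NonZero (size S) →
    ∃[ P ] ∃[ γ ] IsPerformanceRatio x {S} P γ × IsIntegralityGap x S γ
theorem7p2 R n x x≥0 S size≢0 = Relaxation.achieved R x x≥0 S (some-index size≢0)
  where
  some-index : ∀ {s} → NonZero s → Fin s
  some-index {suc _} _ = zero
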